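{- Let $P_t$ denote the path of length $t$ (i.e. with $t$ edges). Then, as $n\to\infty$: (i) $C(n,P_4)=\Omega(n^{1/5})$; (ii) $C(n,P_t)=\Omega(n^{1/3})$ for $t\in\{5,6,7\}$; (iii) $C(n,P_t)=\Omega(n^{1/2})$ for every $t\geqslant 8$.
   Context: For a graph $H$ and a positive integer $n$, $C(n,H)$ denotes the minimum integer $k$ such that there exist $n$ colorings $f_v:E(K_n)\to[k]$, one for each vertex $v\in V(K_n)$ (the colorings need not be proper), with the following property: for every copy $T$ of $H$ in $K_n$, there is a vertex $v\in V(T)$ such that $f_v$ assigns pairwise distinct colors to all edges of $E(T)$. -}

module Defs where

open import Data.Nat using (ℕ; suc)
open import Data.Fin using (Fin; inject₁) renaming (suc to fsuc)
open import Data.Product using (Σ; ∃; _×_)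
open import Relation.Binary.PropositionalEquality using (_≡_; _≢_)
open import Function.Definitions using (Injective)

-- An edge colouring of K_n with colours [k] = Fin k (not necessarily proper).
-- Edges of K_n are unordered pairs {u,w}, u ≠ w; we represent a colouring as a
-- symmetric function on ordered pairs (its values on the diagonal are irrelevant).
EdgeColoring : ℕ → ℕ → Set
EdgeColoring n k = Σ (Fin n → Fin n → Fin k) (λ c → ∀ u w → c u w ≡ c w u)

colour : ∀ {n k} → EdgeColoring n k → Fin n → Fin n → Fin k
colour c u w = Σ.proj₁ c u w

-- A copy of the path P_t (t edges) in K_n: an injective sequence of t+1 vertices
-- p 0, …, p t; its edges are {p j, p (j+1)} for j < t.
PathCopy : ℕ → ℕ → Set
PathCopy n t = Σ (Fin (suc t) → Fin n) (λ p → Injective _≡_ _≡_ p)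

Rainbow : ∀ {n k t} → EdgeColoring n k → (Fin (suc t) → Fin n) → Set
Rainbow {t = t} c p =
  (j j' : Fin t) → j ≢ j' →
  colour c (p (inject₁ j)) (p (fsuc j)) ≢ colour c (p (inject₁ j')) (p (fsuc j'))

GoodFamily : (n t k : ℕ) → (Fin n → EdgeColoring n k) → Set
GoodFamily n t k f =
  (T : PathCopy n t) → ∃ λ (i : Fin (suc t)) → Rainbow (f (Σ.proj₁ T i)) (Σ.proj₁ T)

-- k colours suffice for (n, P_t); C(n,P_t) is the least such k.
Achievable : (n t k : ℕ) → Set
Achievable n t k = Σ (Fin n → EdgeColoring n k) (GoodFamily n t k)

{-# OPTIONS --safe #-}
module Submission where

-- A path is rainbow for no colouring f_v of its vertices as soon as every f_v repeats a
-- colour on it; such paths are found by double counting.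
--
-- Key count: if k colours are given to a set M of 2rk points, at least half of M lies in
-- classes with more than r points.
--
-- Length 4.  Apply this with r = 2 to the colourings w ↦ f_b(bw) of a set M of 4k vertices:
-- averaging over b gives a, c, e in M and more than k³ vertices b with
-- f_b(ba) = f_b(bc) = f_b(be).  Two of these, b and d, agree on f_a(bc), f_c(bc), f_e(bc), and
-- the path a b c d e repeats a colour at every vertex.
--
-- Length ≥ 5.  Fix u and 2k vertices M on which w ↦ f_u(uw) is constant.  Averaging (r = 1)
-- gives x, y in M and a set B of order n/k of vertices v with f_v(ux) = f_v(uy).  A path
-- through x u y whose other vertices lie in B repeats a colour for all its vertices except
-- possibly x and y.  If |B| > k² + 1, a star in B has two edges p q, q r on which both f_x and f_y
-- are constant, giving x u y p q r; if only |B| > 2k + 3, two disjoint stars serve x and y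
-- separately, giving p q r x u y p' q' r'.

open import Defs
open import Data.Nat using (ℕ; zero; suc; _+_; _*_; _^_; _≤_; _<_; z≤n; s≤s; NonZero; _<?_)
open import Data.Nat.Properties using (≤-trans; <⇒≤; ≤-reflexive; <-≤-trans; ≤-<-trans; ≮⇒≥; n≮n; +-suc; +-commutativeSemigroup; +-identityʳ; +-mono-≤; +-monoˡ-≤; +-monoʳ-≤; +-cancelˡ-<; +-cancelʳ-≤; *-identityʳ; *-comm; *-distribʳ-+; *-monoʳ-≤; *-monoʳ-<; ^-monoʳ-≤; m*n≢0; m≤n⇒∃[o]m+o≡n; module ≤-Reasoning)
open import Algebra.Properties.CommutativeSemigroup +-commutativeSemigroup using (x∙yz≈y∙xz)
open import Data.Nat.ListAction using (sum)
open import Data.Nat.Tactic.RingSolver using (solve-∀)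
open import Data.Fin using (Fin; zero; suc; combine; #_)
open import Data.Fin.Properties using (_≟_; pigeonhole; combine-injective; <⇒≢)
open import Data.List using (List; []; _∷_; length; filter; map; lookup; allFin; cartesianProduct)
open import Data.List.Properties using (filter-accept; length-tabulate; length-++; length-map)
open import Data.List.Membership.Propositional using (_∈_)
open import Data.List.Membership.Propositional.Properties using (∈-filter⁺; ∈-filter⁻; ∈-allFin; ∈-lookup; ∈-length; ∈-cartesianProduct⁺; ∈-cartesianProduct⁻)
open import Data.List.Relation.Binary.Sublist.Propositional.Properties using (filter-⊆; filter⁺; length-mono-≤; All-resp-⊆)
open import Data.List.Relation.Binary.Sublist.Propositional using (_⊆_; []; _∷_; _∷ʳ_; ⊆-trans) renaming (lookup to ∈-resp-⊆)
open import Data.List.Relation.Unary.All as All using (All; []; _∷_)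
open import Data.List.Relation.Unary.AllPairs using ([]; _∷_)
open import Data.List.Relation.Unary.Any using (here; there)
open import Data.List.Relation.Unary.Unique.Propositional using (Unique)
open import Data.List.Relation.Unary.Unique.Propositional.Properties using (allFin⁺) renaming (filter⁺ to unique-filter⁺)
open import Data.Product using (∃; ∃₂; _×_; _,_; proj₁; proj₂)
open import Data.Empty using (⊥)
open import Function using (_∘_; id)
open import Relation.Nullary using (¬_; Dec; yes; no; ¬?; contradiction; _×-dec_)
open import Relation.Unary using (Pred; Decidable)
open import Relation.Unary.Properties using (∁?)
open import Relation.Binary.PropositionalEquality using (_≡_; _≢_; refl; sym; trans; cong; cong₂; subst; ≢-sym)
open import Level using (0ℓ)

private
  variable
    A B : Set
    n k : ℕ

-- Counting in lists

count : {P : Pred A 0ℓ} → Decidable P → List A → ℕ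
count P? xs = length (filter P? xs)

count-complement : {P : Pred A 0ℓ} (P? : Decidable P) (xs : List A) →
                   length xs ≡ count P? xs + count (∁? P?) xs
count-complement P? []       = refl
count-complement P? (x ∷ xs) with P? x
... | yes _ = cong suc (count-complement P? xs)
... | no  _ = trans (cong suc (count-complement P? xs)) (sym (+-suc _ _))

count-pos : {P : Pred A 0ℓ} (P? : Decidable P) {x : A} {xs : List A} →
            x ∈ xs → P x → 1 ≤ count P? xs
count-pos P? x∈ px = ∈-length (∈-filter⁺ P? x∈ px)

nonempty : (xs : List A) → 0 < length xs → ∃ λ x → x ∈ xs
nonempty (x ∷ _) _ = x , here refl

module _ {R : A → B → Set} (R? : ∀ x y → Dec (R x y)) where

  incidences : List A → List B → ℕ
  incidences xs ys = sum (map (λ x → count (R? x) ys) xs)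

  incidences-[] : ∀ xs → incidences xs [] ≡ 0
  incidences-[] []       = refl
  incidences-[] (_ ∷ xs) = incidences-[] xs

  -- `incidences` adds up rows; peeling off one column at a time is what lets the same total be
  -- estimated by columns.
  incidences-∷ : ∀ xs y ys →
                 incidences xs (y ∷ ys) ≡ count (λ x → R? x y) xs + incidences xs ys
  insert-count : ∀ x xs y ys → count (R? x) ys + incidences xs (y ∷ ys) ≡
                 count (λ x → R? x y) xs + (count (R? x) ys + incidences xs ys)

  incidences-∷ []       y ys = refl
  incidences-∷ (x ∷ xs) y ys with R? x y
  ... | yes _ = cong suc (insert-count x xs y ys)
  ... | no  _ = insert-count x xs y ys

  insert-count x xs y ys =
    trans (cong (count (R? x) ys +_) (incidences-∷ xs y ys))
          (x∙yz≈y∙xz (count (R? x) ys) (count (λ x → R? x y) xs) (incidences xs ys))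

  incidences-≥ : ∀ w xs ys → (∀ {x} → x ∈ xs → w ≤ count (R? x) ys) →
                 length xs * w ≤ incidences xs ys
  incidences-≥ w []       ys h = z≤n
  incidences-≥ w (x ∷ xs) ys h = +-mono-≤ (h (here refl)) (incidences-≥ w xs ys (h ∘ there))

  heavy-column : ∀ s xs ys → length ys * s < incidences xs ys →
                 ∃ λ y → y ∈ ys × s < count (λ x → R? x y) xs
  heavy-column s xs [] lt = contradiction (subst (0 <_) (incidences-[] xs) lt) (n≮n 0)
  heavy-column s xs (y ∷ ys) lt with s <? count (λ x → R? x y) xs
  ... | yes p = y , here refl , p
  ... | no ¬p with heavy-column s xs ys rest
    where
    rest : length ys * s < incidences xs ys
    rest = +-cancelˡ-< s _ _ (<-≤-trans lt
             (≤-trans (≤-reflexive (incidences-∷ xs y ys)) (+-monoˡ-≤ _ (≮⇒≥ ¬p))))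
  ...   | z , z∈ , q = z , there z∈ , q

  double-counting : ∀ w s xs ys → (∀ {x} → x ∈ xs → w ≤ count (R? x) ys) →
                    length ys * s < length xs * w →
                    ∃ λ y → y ∈ ys × s < count (λ x → R? x y) xs
  double-counting w s xs ys h lt = heavy-column s xs ys (<-≤-trans lt (incidences-≥ w xs ys h))

  popular-choice : ∀ s xs ys → (∀ {x} → x ∈ xs → ∃ λ y → y ∈ ys × R x y) →
                   length ys * s < length xs →
                   ∃ λ y → y ∈ ys × s < count (λ x → R? x y) xs
  popular-choice s xs ys h lt =
    double-counting 1 s xs ys (λ x∈ → let (y , y∈ , r) = h x∈ in count-pos (R? _) y∈ r)
      (subst (length ys * s <_) (sym (*-identityʳ _)) lt)

large-fibre : (φ : A → Fin k) (s : ℕ) (xs : List A) → k * s < length xs →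
              ∃ λ c → s < count (λ x → φ x ≟ c) xs
large-fibre {k = k} φ s xs lt
  with c , _ , p ← popular-choice (λ x c → φ x ≟ c) s xs (allFin k)
                     (λ {x} _ → φ x , ∈-allFin _ , refl)
                     (subst (λ m → m * s < length xs) (sym (length-tabulate {n = k} id)) lt)
  = c , p

lookup-injective : {xs : List A} → Unique xs → ∀ {i j} → lookup xs i ≡ lookup xs j → i ≡ j
lookup-injective {xs = _ ∷ _} _        {zero}  {zero}  _  = refl
lookup-injective {xs = _ ∷ _} (x∉ ∷ _) {zero}  {suc j} eq = contradiction eq (All.lookup x∉ (∈-lookup j))
lookup-injective {xs = _ ∷ _} (x∉ ∷ _) {suc i} {zero}  eq = contradiction (sym eq) (All.lookup x∉ (∈-lookup i))
lookup-injective {xs = _ ∷ _} (_ ∷ u)  {suc i} {suc j} eq = cong suc (lookup-injective u eq)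

collision : (φ : A → Fin k) (xs : List A) → Unique xs → k < length xs →
            ∃₂ λ x y → x ∈ xs × y ∈ xs × x ≢ y × φ x ≡ φ y
collision φ xs u lt with i , j , i<j , eq ← pigeonhole lt (φ ∘ lookup xs)
  = lookup xs i , lookup xs j , ∈-lookup i , ∈-lookup j , <⇒≢ i<j ∘ lookup-injective u , eq

length-cartesianProduct : (xs : List A) (ys : List B) →
                          length (cartesianProduct xs ys) ≡ length xs * length ys
length-cartesianProduct []       ys = refl
length-cartesianProduct (x ∷ xs) ys =
  trans (length-++ (map (x ,_) ys)) (cong₂ _+_ (length-map (x ,_) ys) (length-cartesianProduct xs ys))

Unique-resp-⊆ : {xs ys : List A} → xs ⊆ ys → Unique ys → Unique xs
Unique-resp-⊆ []          []       = []
Unique-resp-⊆ (_ ∷ʳ p)    (_ ∷ u)  = Unique-resp-⊆ p u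
Unique-resp-⊆ (refl ∷ p)  (x∉ ∷ u) = All-resp-⊆ p x∉ ∷ Unique-resp-⊆ p u

-- The length of `first` is exact because it may serve as the set averaged over, or as the tail that
-- brings a path to its prescribed length; `rest` only has to be large.
record Split (e s : ℕ) (xs : List A) : Set where
  field
    first rest   : List A
    first-length : length first ≡ e
    rest-length  : s ≤ length rest
    first-unique : Unique first
    rest-unique  : Unique rest
    first⊆       : ∀ {v} → v ∈ first → v ∈ xs
    rest⊆        : ∀ {v} → v ∈ rest → v ∈ xs
    apart        : ∀ {v w} → v ∈ first → w ∈ rest → v ≢ w

split : ∀ e s (xs : List A) → Unique xs → e + s ≤ length xs → Split e s xs
split zero s xs u le = record
  { first = [] ; rest = xs ; first-length = refl ; rest-length = le
  ; first-unique = [] ; rest-unique = u ; first⊆ = λ () ; rest⊆ = id ; apart = λ () }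
split (suc e) s (x ∷ xs) (x∉ ∷ u) (s≤s le) = record
  { first = x ∷ first ; rest = rest ; first-length = cong suc first-length ; rest-length = rest-length
  ; first-unique = All.tabulate (All.lookup x∉ ∘ first⊆) ∷ first-unique ; rest-unique = rest-unique
  ; first⊆ = λ { (here refl) → here refl ; (there v∈) → there (first⊆ v∈) }
  ; rest⊆ = there ∘ rest⊆
  ; apart = λ { (here refl) w∈ → All.lookup x∉ (rest⊆ w∈) ; (there v∈) w∈ → apart v∈ w∈ } }
  where open Split (split e s xs u le)

-- Monochromatic pairs and triples

module _ (φ : A → Fin k) (M : List A) where

  classSize : A → ℕ
  classSize i = count (λ j → φ j ≟ φ i) M

  large? : ∀ r → Decidable (λ i → r < classSize i)
  large? r i = r <? classSize i

  -- Otherwise more than `r` of the points in small classes share a colour, and the class of any of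
  -- these is not small after all.
  few-in-small-classes : ∀ r → count (∁? (large? r)) M ≤ k * r
  few-in-small-classes r = ≮⇒≥ λ lt →
    let small = filter (∁? (large? r)) M
        c , r<c      = large-fibre φ r small lt
        y , y∈       = nonempty (filter (λ x → φ x ≟ c) small) (≤-<-trans z≤n r<c)
        y∈small , φy = ∈-filter⁻ (λ x → φ x ≟ c) y∈
        ¬large       = proj₂ (∈-filter⁻ (∁? (large? r)) {xs = M} y∈small)
        -- Passing from the small points back to all of `M` can only enlarge the class.
        r<M          = <-≤-trans r<c (length-mono-≤
                         (filter⁺ (λ x → φ x ≟ c) (λ x → φ x ≟ c) (λ { refl p → p }) (filter-⊆ (∁? (large? r)) M)))
    in ¬large (subst (λ d → r < count (λ x → φ x ≟ d) M) (sym φy) r<M)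

  many-in-large-classes : ∀ r → length M ≡ k * r + k * r → k * r ≤ count (large? r) M
  many-in-large-classes r |M| = +-cancelʳ-≤ (k * r) _ _ (begin
    k * r + k * r                                   ≡⟨ |M| ⟨
    length M                                        ≡⟨ count-complement (large? r) M ⟩
    count (large? r) M + count (∁? (large? r)) M    ≤⟨ +-monoʳ-≤ _ (few-in-small-classes r) ⟩
    count (large? r) M + k * r                      ∎)
    where open ≤-Reasoning

-- Once `i` is met, uniqueness lets every later entry pass the filter, so at most one entry is lost.
count-others : (i : Fin n) (xs : List (Fin n)) → Unique xs →
               length xs ≤ suc (count (λ j → ¬? (j ≟ i)) xs)
count-others i []       _        = z≤n
count-others i (x ∷ xs) (x∉ ∷ u) with x ≟ i
... | no  _    = s≤s (count-others i xs u)
... | yes refl = s≤s (≤-reflexive (sym (cong length (all-others xs x∉))))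
  where
  all-others : ∀ ys → All (i ≢_) ys → filter (λ j → ¬? (j ≟ i)) ys ≡ ys
  all-others []       []       = refl
  all-others (y ∷ ys) (p ∷ ps) =
    trans (filter-accept (λ j → ¬? (j ≟ i)) (≢-sym p)) (cong (y ∷_) (all-others ys ps))

module _ (φ : Fin n → Fin k) (M : List (Fin n)) (M! : Unique M) (i : Fin n) where

  private
    others : List (Fin n)
    others = filter (λ j → ¬? (j ≟ i)) (filter (λ j → φ j ≟ φ i) M)

    others! : Unique others
    others! = unique-filter⁺ _ (unique-filter⁺ _ M!)

    -- The class may contain `i` itself, so more than `r` points guarantee only `r` partners.
    others-≥ : ∀ {r} → r < classSize φ M i → suc r ≤ suc (length others)
    others-≥ lt = ≤-trans lt (count-others i _ (unique-filter⁺ _ M!))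

    others⁻ : ∀ {j} → j ∈ others → j ∈ M × j ≢ i × φ j ≡ φ i
    others⁻ j∈ with j∈c , j≢i ← ∈-filter⁻ (λ j → ¬? (j ≟ i)) {xs = filter (λ j → φ j ≟ φ i) M} j∈
                with j∈M , eq ← ∈-filter⁻ (λ j → φ j ≟ φ i) {xs = M} j∈c = j∈M , j≢i , eq

  partner : 1 < classSize φ M i → ∃ λ j → j ∈ M × j ≢ i × φ j ≡ φ i
  partner lt with others | others-≥ lt | others⁻
  ... | []    | s≤s () | _
  ... | j ∷ _ | _      | spec = j , spec (here refl)

  two-partners : 2 < classSize φ M i → ∃₂ λ j l → j ≢ l × (j ∈ M × j ≢ i × φ j ≡ φ i) × (l ∈ M × l ≢ i × φ l ≡ φ i)
  two-partners lt with others | others-≥ lt | others⁻ | others!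
  ... | []        | s≤s ()       | _    | _
  ... | _ ∷ []    | s≤s (s≤s ()) | _    | _
  ... | j ∷ l ∷ _ | _            | spec | (j≢l ∷ _) ∷ _ =
    j , l , j≢l , spec (here refl) , spec (there (here refl))

module _ (φ : B → Fin n → Fin k) (M : List (Fin n)) (bs : List B) where

  -- For each `b` at least `k * r` points, half of `M`, lie in large classes; so some `i` does for
  -- at least half of `bs`.
  popular-in-large-classes : ∀ .{{_ : NonZero k}} r .{{_ : NonZero r}} s → length M ≡ k * r + k * r →
    2 * s < length bs →
    ∃ λ i → i ∈ M × s < count (λ b → large? (φ b) M r i) bs
  popular-in-large-classes r s |M| lt =
    double-counting (λ b i → large? (φ b) M r i) (k * r) s bs M
      (λ {b} _ → many-in-large-classes (φ b) M r |M|) (begin-strict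
        length M * s              ≡⟨ cong (_* s) |M| ⟩
        (k * r + k * r) * s       ≡⟨ rearrange (k * r) s ⟩
        k * r * (2 * s)           <⟨ *-monoʳ-< (k * r) {{m*n≢0 k r}} lt ⟩
        k * r * length bs         ≡⟨ *-comm (k * r) _ ⟩
        length bs * (k * r)       ∎)
    where
    open ≤-Reasoning
    rearrange : ∀ x s → (x + x) * s ≡ x * (2 * s)
    rearrange = solve-∀


  -- Two averagings: fixing `i` costs a factor 2; each surviving `b` has a partner of `i` in its
  -- class, and fixing the commonest partner costs a factor `length M`.
  popular-pair : ∀ .{{_ : NonZero k}} s → Unique M → length M ≡ k * 1 + k * 1 →
    2 * (length M * s) < length bs →
    ∃₂ λ i j → i ∈ M × j ∈ M × j ≢ i ×
    ∃ λ bs′ → bs′ ⊆ bs × s < length bs′ × (∀ {b} → b ∈ bs′ → φ b j ≡ φ b i)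
  popular-pair s M! |M| lt
    with i , i∈ , p ← popular-in-large-classes 1 (length M * s) |M| lt
    with j , j∈ , q ← popular-choice (λ b j → ¬? (j ≟ i) ×-dec (φ b j ≟ φ b i)) s
                        (filter (λ b → large? (φ b) M 1 i) bs) M
                        (λ b∈ → partner (φ _) M M! i (proj₂ (∈-filter⁻ (λ b → large? (φ b) M 1 i) {xs = bs} b∈)))
                        p
    = let good? = λ b → ¬? (j ≟ i) ×-dec (φ b j ≟ φ b i)
          large = filter (λ b → large? (φ b) M 1 i) bs
          good  = λ {b} (b∈ : b ∈ filter good? large) → proj₂ (∈-filter⁻ good? {xs = large} b∈)
      -- `j ≢ i` does not involve `b`, so it is read off from any one survivor.
      in i , j , i∈ , j∈ , proj₁ (good (proj₂ (nonempty _ (≤-<-trans z≤n q)))) ,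
         filter good? large , ⊆-trans (filter-⊆ good? large) (filter-⊆ _ bs) , q , proj₂ ∘ good

  -- As for pairs, but with `r = 2`, so that a large class leaves two partners; fixing an ordered
  -- pair of them costs `length M * length M`.
  popular-triple : ∀ .{{_ : NonZero k}} s → Unique M → length M ≡ k * 2 + k * 2 →
    2 * (length M * length M * s) < length bs →
    ∃ λ i → ∃₂ λ j l → i ∈ M × j ∈ M × l ∈ M × j ≢ i × l ≢ i × j ≢ l ×
    ∃ λ bs′ → bs′ ⊆ bs × s < length bs′ × (∀ {b} → b ∈ bs′ → φ b j ≡ φ b i × φ b l ≡ φ b i)
  popular-triple s M! |M| lt
    with i , i∈ , p ← popular-in-large-classes 2 (length M * length M * s) |M| lt
    with (j , l) , jl∈ , q ← popular-choice
             (λ { b (j , l) → (¬? (j ≟ i) ×-dec ¬? (l ≟ i) ×-dec ¬? (j ≟ l)) ×-dec (φ b j ≟ φ b i) ×-dec (φ b l ≟ φ b i) }) s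
             (filter (λ b → large? (φ b) M 2 i) bs) (cartesianProduct M M)
             (λ b∈ → let j , l , j≢l , (j∈ , j≢i , ej) , (l∈ , l≢i , el) =
                           two-partners (φ _) M M! i (proj₂ (∈-filter⁻ (λ b → large? (φ b) M 2 i) {xs = bs} b∈))
                     in (j , l) , ∈-cartesianProduct⁺ j∈ l∈ , (j≢i , l≢i , j≢l) , ej , el)
             (subst (λ m → m * s < count (λ b → large? (φ b) M 2 i) bs) (sym (length-cartesianProduct M M)) p)
    = let good? = λ b → (¬? (j ≟ i) ×-dec ¬? (l ≟ i) ×-dec ¬? (j ≟ l)) ×-dec (φ b j ≟ φ b i) ×-dec (φ b l ≟ φ b i)
          large = filter (λ b → large? (φ b) M 2 i) bs
          good  = λ {b} (b∈ : b ∈ filter good? large) → proj₂ (∈-filter⁻ good? {xs = large} b∈)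
          j∈ , l∈ = ∈-cartesianProduct⁻ M M jl∈
          j≢i , l≢i , j≢l = proj₁ (good (proj₂ (nonempty _ (≤-<-trans z≤n q))))
      in i , j , l , i∈ , j∈ , l∈ , j≢i , l≢i , j≢l ,
         filter good? large , ⊆-trans (filter-⊆ good? large) (filter-⊆ _ bs) , q , proj₂ ∘ good

-- Paths without a rainbow colouring

-- The head of the list is the centre, and at least `K + 1` leaves remain for the pigeonhole. `K` is
-- free so that one label can record several colours.
star : {K : ℕ} (g : Fin n → Fin n → Fin K) (vs : List (Fin n)) → Unique vs → 1 + K < length vs →
       ∃₂ λ p q → ∃ λ r → p ∈ vs × q ∈ vs × r ∈ vs × p ≢ q × p ≢ r × q ≢ r × g q p ≡ g q r
star g (q ∷ vs) (q∉ ∷ vs!) (s≤s lt) =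
  let p , r , p∈ , r∈ , p≢r , eq = collision (g q) vs vs! lt
  in p , q , r , there p∈ , here refl , there r∈ ,
     ≢-sym (All.lookup q∉ p∈) , p≢r , All.lookup q∉ r∈ , eq

-- Estimates for the number of vertices needed

pow-≤ : ∀ k .{{_ : NonZero k}} c {i j} → i ≤ j → c * k ^ i ≤ c * k ^ j
pow-≤ k c i≤j = *-monoʳ-≤ c (^-monoʳ-≤ k i≤j)

-- The set averaged over takes `m = 4k` vertices. The candidates for `b` and `d` must exceed
-- `2 * m * m` times `k³`, the number of colour triples. As `k ≥ 1`, `4k + 32k⁵` is at most `36k⁵`.
room-for-P₄ : ∀ k .{{_ : NonZero k}} → let m = k * 2 + k * 2 in
  m + suc (2 * (m * m * (k * (k * k)))) ≤ suc (36 * k ^ 5)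
room-for-P₄ k = begin
  m + suc (2 * (m * m * (k * (k * k))))  ≡⟨ expand k ⟩
  suc (4 * k ^ 1 + 32 * k ^ 5)           ≤⟨ s≤s (+-monoˡ-≤ (32 * k ^ 5) (pow-≤ k 4 {1} {5} (s≤s z≤n))) ⟩
  suc (4 * k ^ 5 + 32 * k ^ 5)           ≡⟨ cong suc (*-distribʳ-+ (k ^ 5) 4 32) ⟨
  suc (36 * k ^ 5)                       ∎
  where
  open ≤-Reasoning
  m = k * 2 + k * 2
  expand : ∀ k → k * 2 + k * 2 + (1 + 2 * ((k * 2 + k * 2) * (k * 2 + k * 2) * (k * (k * k)))) ≡
           1 + (4 * (k * 1) + 32 * (k * (k * (k * (k * (k * 1))))))
  expand = solve-∀

-- One vertex u, then k (2k) + 1 vertices containing 2k in one class of w ↦ f_u(uw), then more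
-- than 4ks vertices to average over.
cherrySize : ℕ → ℕ → ℕ
cherrySize k s = suc (suc (k * (k * 1 + k * 1)) + suc (2 * ((k * 1 + k * 1) * s)))

-- Of the vertices the cherry leaves, `e` prolong the path and `k² + 2` hold a star labelled by
-- pairs of colours. The constant adds up the coefficients once every power is raised to `k³`.
room-for-P₅₊ : ∀ e k .{{_ : NonZero k}} → cherrySize k (e + suc (k * k)) ≤ suc ((12 + 4 * e) * k ^ 3)
room-for-P₅₊ e k = begin
  cherrySize k (e + suc (k * k))
    ≡⟨ expand e k ⟩
  suc (2 * k ^ 0 + (2 * k ^ 2 + ((4 + 4 * e) * k ^ 1 + 4 * k ^ 3)))
    ≤⟨ s≤s (+-mono-≤ (pow-≤ k 2 {0} {3} z≤n) (+-mono-≤ (pow-≤ k 2 {2} {3} (s≤s (s≤s z≤n)))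
         (+-monoˡ-≤ (4 * k ^ 3) (pow-≤ k (4 + 4 * e) {1} {3} (s≤s z≤n))))) ⟩
  suc (2 * k ^ 3 + (2 * k ^ 3 + ((4 + 4 * e) * k ^ 3 + 4 * k ^ 3)))
    ≡⟨ collect e (k ^ 3) ⟩
  suc ((12 + 4 * e) * k ^ 3) ∎
  where
  open ≤-Reasoning
  expand : ∀ e k → 1 + ((1 + k * (k * 1 + k * 1)) + (1 + 2 * ((k * 1 + k * 1) * (e + (1 + k * k))))) ≡
           1 + (2 * 1 + (2 * (k * (k * 1)) + ((4 + 4 * e) * (k * 1) + 4 * (k * (k * (k * 1))))))
  expand = solve-∀
  collect : ∀ e x → 1 + (2 * x + (2 * x + ((4 + 4 * e) * x + 4 * x))) ≡ 1 + ((12 + 4 * e) * x)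
  collect = solve-∀

-- Two stars labelled by single colours take `k + 2` vertices each, so every term stays at most
-- quadratic in `k`.
room-for-P₈₊ : ∀ e k .{{_ : NonZero k}} → cherrySize k (e + (1 + k + (2 + k))) ≤ suc ((24 + 4 * e) * k ^ 2)
room-for-P₈₊ e k = begin
  cherrySize k (e + (1 + k + (2 + k)))
    ≡⟨ expand e k ⟩
  suc (2 * k ^ 0 + ((12 + 4 * e) * k ^ 1 + 10 * k ^ 2))
    ≤⟨ s≤s (+-mono-≤ (pow-≤ k 2 {0} {2} z≤n)
         (+-monoˡ-≤ (10 * k ^ 2) (pow-≤ k (12 + 4 * e) {1} {2} (s≤s z≤n)))) ⟩
  suc (2 * k ^ 2 + ((12 + 4 * e) * k ^ 2 + 10 * k ^ 2))
    ≡⟨ collect e (k ^ 2) ⟩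
  suc ((24 + 4 * e) * k ^ 2) ∎
  where
  open ≤-Reasoning
  expand : ∀ e k → 1 + ((1 + k * (k * 1 + k * 1)) + (1 + 2 * ((k * 1 + k * 1) * (e + (1 + k + (2 + k)))))) ≡
           1 + (2 * 1 + ((12 + 4 * e) * (k * 1) + 10 * (k * (k * 1))))
  expand = solve-∀
  collect : ∀ e x → 1 + (2 * x + ((12 + 4 * e) * x + 10 * x)) ≡ 1 + ((24 + 4 * e) * x)
  collect = solve-∀

-- Paths of length 4, and cherries

module _ (f : Fin n → EdgeColoring n k) where

  col : Fin n → Fin n → Fin n → Fin k
  col v = colour (f v)

  col-sym : ∀ v a b → col v a b ≡ col v b a
  col-sym v = proj₂ (f v)

  no-bad-path : ∀ x xs → GoodFamily n (length xs) k f → Unique (x ∷ xs) →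
                ¬ All (λ v → ¬ Rainbow (f v) (lookup (x ∷ xs))) (x ∷ xs)
  no-bad-path x xs good u bad with i , rainbow ← good (lookup (x ∷ xs) , lookup-injective u)
    = All.lookup bad (∈-lookup i) rainbow

  -- The middle edges `bc` and `cd` agree at `a`, `c` and `e`; at `b` and at `d` the repetition is
  -- between the two path edges meeting there.
  P₄-obstruction : GoodFamily n 4 k f → ∀ {a b c d e} → Unique (a ∷ b ∷ c ∷ d ∷ e ∷ []) →
           col b b a ≡ col b b c → col d d e ≡ col d d c →
           col a b c ≡ col a d c → col c b c ≡ col c d c → col e b c ≡ col e d c → ⊥
  P₄-obstruction good {a} {b} {c} {d} {e} u eqb eqd eqa eqc eqe =
    no-bad-path a (b ∷ c ∷ d ∷ e ∷ []) good u
      ((λ rainbow → rainbow (# 1) (# 2) (λ ()) (trans eqa (col-sym a d c))) ∷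
       (λ rainbow → rainbow (# 0) (# 1) (λ ()) (trans (col-sym b a b) eqb)) ∷
       (λ rainbow → rainbow (# 1) (# 2) (λ ()) (trans eqc (col-sym c d c))) ∷
       (λ rainbow → rainbow (# 2) (# 3) (λ ()) (trans (col-sym d c d) (sym eqd))) ∷
       (λ rainbow → rainbow (# 1) (# 2) (λ ()) (trans eqe (col-sym e d c))) ∷ [])

  no-good-family-P₄ : .{{_ : NonZero k}} → 36 * k ^ 5 < n → ¬ GoodFamily n 4 k f
  no-good-family-P₄ lt good =
    let m = k * 2 + k * 2
        S = split m (suc (2 * (m * m * (k * (k * k))))) (allFin n) (allFin⁺ n)
              (≤-trans (≤-trans (room-for-P₄ k) lt) (≤-reflexive (sym (length-tabulate {n = n} id))))
        open Split S
        -- The vertex that the other two are compared with becomes the middle of the path, those two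
        -- its ends.
        c , a , e , c∈ , a∈ , e∈ , a≢c , e≢c , a≢e , bs , bs⊆ , bs-length , same =
          popular-triple (λ b w → col b b w) first rest (k * (k * k)) first-unique first-length
            (subst (λ m → 2 * (m * m * (k * (k * k))) < length rest) (sym first-length) rest-length)
        b , d , b∈ , d∈ , b≢d , eq =
          -- The three colours of `bc` are packed into one label out of `k * (k * k)`, fewer than
          -- the members of `bs`.
          collision (λ b → combine (col a b c) (combine (col c b c) (col e b c))) bs
            (Unique-resp-⊆ bs⊆ rest-unique) bs-length
        eqa , eq′ = combine-injective (col a b c) _ _ _ eq
        eqc , eqe = combine-injective (col c b c) _ _ _ eq′
        b∈′ = ∈-resp-⊆ bs⊆ b∈
        d∈′ = ∈-resp-⊆ bs⊆ d∈
    in P₄-obstruction good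
        ((apart a∈ b∈′ ∷ a≢c ∷ apart a∈ d∈′ ∷ a≢e ∷ []) ∷
         (≢-sym (apart c∈ b∈′) ∷ b≢d ∷ ≢-sym (apart e∈ b∈′) ∷ []) ∷
         (apart c∈ d∈′ ∷ ≢-sym e≢c ∷ []) ∷
         (≢-sym (apart e∈ d∈′) ∷ []) ∷ [] ∷ [])
        (proj₁ (same b∈)) (proj₂ (same d∈)) eqa eqc eqe

  -- The edges `xu` and `uy` spoil every path through them for the colourings of `u` and of all
  -- `others`; only `x` and `y` remain to be dealt with.
  record Cherry (s : ℕ) : Set where
    field
      u x y      : Fin n
      others     : List (Fin n)
      x≢u        : x ≢ u
      y≢u        : y ≢ u
      x≢y        : x ≢ y
      u≢         : ∀ {v} → v ∈ others → u ≢ v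
      x≢         : ∀ {v} → v ∈ others → x ≢ v
      y≢         : ∀ {v} → v ∈ others → y ≢ v
      unique     : Unique others
      s<length   : s < length others
      repeated   : ∀ {v} → v ∈ others → col v x u ≡ col v u y
      repeated-u : col u x u ≡ col u u y

  cherry-in : .{{_ : NonZero k}} → ∀ s (vs : List (Fin n)) → Unique vs →
           cherrySize k s ≤ length vs → Cherry s
  cherry-in s (u ∷ vs) (u∉ ∷ vs!) (s≤s le) =
    let m = k * 1 + k * 1
        S = split (suc (k * m)) (suc (2 * (m * s))) vs vs! le
        open Split S
        c , p = large-fibre (col u u) m first (≤-reflexive (sym first-length))
        class? = λ w → col u u w ≟ c
        -- The class of more than `2k` vertices is cut down to exactly `2k`, the size required for
        -- averaging over pairs.
        S′ = split m 0 (filter class? first) (unique-filter⁺ class? first-unique)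
               (≤-trans (≤-reflexive (+-identityʳ m)) (<⇒≤ p))
        M = Split.first S′
        |M|≡m = Split.first-length S′
        x , y , x∈ , y∈ , y≢x , bs , bs⊆ , bs-length , same =
          popular-pair (λ v w → col v u w) M rest s (Split.first-unique S′) |M|≡m
            (subst (λ m → 2 * (m * s) < length rest) (sym |M|≡m) rest-length)
        x∈S , cx = ∈-filter⁻ class? {xs = first} (Split.first⊆ S′ x∈)
        y∈S , cy = ∈-filter⁻ class? {xs = first} (Split.first⊆ S′ y∈)
    in record
      { u = u ; x = x ; y = y ; others = bs
      ; x≢u = ≢-sym (All.lookup u∉ (first⊆ x∈S))
      ; y≢u = ≢-sym (All.lookup u∉ (first⊆ y∈S))
      ; x≢y = ≢-sym y≢x
      ; u≢ = λ v∈ → All.lookup u∉ (rest⊆ (∈-resp-⊆ bs⊆ v∈))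
      ; x≢ = λ v∈ → apart x∈S (∈-resp-⊆ bs⊆ v∈)
      ; y≢ = λ v∈ → apart y∈S (∈-resp-⊆ bs⊆ v∈)
      ; unique = Unique-resp-⊆ bs⊆ rest-unique
      ; s<length = bs-length
      ; repeated = λ {v} v∈ → trans (col-sym v x u) (sym (same v∈))
      ; repeated-u = trans (col-sym u x u) (trans cx (sym cy)) }

  cherry : .{{_ : NonZero k}} → ∀ s → cherrySize k s ≤ n → Cherry s
  cherry s le = cherry-in s (allFin n) (allFin⁺ n) (≤-trans le (≤-reflexive (sym (length-tabulate {n = n} id))))

  -- Paths of length at least 5 through a cherry

  module _ {e : ℕ} where

    -- Edges 3 and 4, the star, serve both `x` and `y`; edges 0 and 1, the cherry, serve all other
    -- vertices, including those of `ext`, whose number is therefore arbitrary.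
    P₅₊-obstruction : GoodFamily n (5 + e) k f → ∀ {x u y p q r ext} → length ext ≡ e →
              Unique (x ∷ u ∷ y ∷ p ∷ q ∷ r ∷ ext) →
              col u x u ≡ col u u y → All (λ v → col v x u ≡ col v u y) (p ∷ q ∷ r ∷ ext) →
              col x q p ≡ col x q r → col y q p ≡ col y q r → ⊥
    P₅₊-obstruction good {x} {u} {y} {p} {q} {r} {ext} refl uniq equ eqs eqx eqy =
      no-bad-path x (u ∷ y ∷ p ∷ q ∷ r ∷ ext) good uniq
        ((λ rainbow → rainbow (# 3) (# 4) (λ ()) (trans (col-sym x p q) eqx)) ∷
         (λ rainbow → rainbow (# 0) (# 1) (λ ()) equ) ∷
         (λ rainbow → rainbow (# 3) (# 4) (λ ()) (trans (col-sym y p q) eqy)) ∷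
         All.map (λ eq rainbow → rainbow (# 0) (# 1) (λ ()) eq) eqs)

    -- The star before the cherry (edges 0 and 1) serves `x`, the star after it (edges 6 and 7)
    -- serves `y`, and the cherry (edges 3 and 4) the rest.
    P₈₊-obstruction : GoodFamily n (8 + e) k f → ∀ {p q r x u y p′ q′ r′ ext} → length ext ≡ e →
              Unique (p ∷ q ∷ r ∷ x ∷ u ∷ y ∷ p′ ∷ q′ ∷ r′ ∷ ext) →
              col u x u ≡ col u u y →
              All (λ v → col v x u ≡ col v u y) (p ∷ q ∷ r ∷ p′ ∷ q′ ∷ r′ ∷ ext) →
              col x q p ≡ col x q r → col y q′ p′ ≡ col y q′ r′ → ⊥
    P₈₊-obstruction good {p} {q} {r} {x} {u} {y} {p′} {q′} {r′} {ext} refl uniq equ (ep ∷ eq ∷ er ∷ eqs) eqx eqy =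
      no-bad-path p (q ∷ r ∷ x ∷ u ∷ y ∷ p′ ∷ q′ ∷ r′ ∷ ext) good uniq
        ((λ rainbow → rainbow (# 3) (# 4) (λ ()) ep) ∷
         (λ rainbow → rainbow (# 3) (# 4) (λ ()) eq) ∷
         (λ rainbow → rainbow (# 3) (# 4) (λ ()) er) ∷
         (λ rainbow → rainbow (# 0) (# 1) (λ ()) (trans (col-sym x p q) eqx)) ∷
         (λ rainbow → rainbow (# 3) (# 4) (λ ()) equ) ∷
         (λ rainbow → rainbow (# 6) (# 7) (λ ()) (trans (col-sym y p′ q′) eqy)) ∷
         All.map (λ eq rainbow → rainbow (# 3) (# 4) (λ ()) eq) eqs)

    no-good-family-P₅₊ : Cherry (e + suc (k * k)) → ¬ GoodFamily n (5 + e) k f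
    no-good-family-P₅₊ C good =
      let open Cherry C
          -- The first `e` vertices prolong the path; the others include a centre and `k * k + 1`
          -- leaves.
          S = split e (2 + k * k) others unique (subst (_≤ length others) (sym (+-suc e _)) s<length)
          open Split S
          p , q , r , p∈ , q∈ , r∈ , p≢q , p≢r , q≢r , eq =
            -- A label holds the colours under both `f_x` and `f_y`, so one collision makes both
            -- repeat on the same two edges.
            star (λ q w → combine (col x q w) (col y q w)) rest rest-unique rest-length
          eqx , eqy = combine-injective (col x q p) _ _ _ eq
          others∋ : ∀ {v} → v ∈ p ∷ q ∷ r ∷ first → v ∈ others
          others∋ = All.lookup (rest⊆ p∈ ∷ rest⊆ q∈ ∷ rest⊆ r∈ ∷ All.tabulate first⊆)
          ≢first : ∀ {v} → v ∈ rest → All (v ≢_) first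
          ≢first v∈ = All.tabulate (λ w∈ → ≢-sym (apart w∈ v∈))
      in P₅₊-obstruction good first-length
           ((x≢u ∷ x≢y ∷ All.tabulate (x≢ ∘ others∋)) ∷
            (≢-sym y≢u ∷ All.tabulate (u≢ ∘ others∋)) ∷
            All.tabulate (y≢ ∘ others∋) ∷
            (p≢q ∷ p≢r ∷ ≢first p∈) ∷ (q≢r ∷ ≢first q∈) ∷ ≢first r∈ ∷ first-unique)
           repeated-u (All.tabulate (repeated ∘ others∋)) eqx eqy

    no-good-family-P₈₊ : Cherry (e + (1 + k + (2 + k))) → ¬ GoodFamily n (8 + e) k f
    no-good-family-P₈₊ C good =
      let open Cherry C
          S = split e ((2 + k) + (2 + k)) others unique
                (subst (_≤ length others) (sym (+-suc e _)) s<length)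
          open Split S
          -- Two disjoint blocks, each with room for a centre and `k + 1` leaves, keep the two stars
          -- apart.
          S′ = split (2 + k) (2 + k) rest rest-unique rest-length
          open Split S′ renaming (first to vs; rest to vs′; first-length to |vs|; rest-length to |vs′|;
            first-unique to vs!; rest-unique to vs′!; first⊆ to vs⊆; rest⊆ to vs′⊆; apart to apart′)
          p , q , r , p∈ , q∈ , r∈ , p≢q , p≢r , q≢r , eqx =
            star (col x) vs vs! (≤-reflexive (sym |vs|))
          p′ , q′ , r′ , p′∈ , q′∈ , r′∈ , p′≢q′ , p′≢r′ , q′≢r′ , eqy =
            star (col y) vs′ vs′! |vs′|
          others∋ : ∀ {v} → v ∈ p ∷ q ∷ r ∷ p′ ∷ q′ ∷ r′ ∷ first → v ∈ others
          others∋ = All.lookup (rest⊆ (vs⊆ p∈) ∷ rest⊆ (vs⊆ q∈) ∷ rest⊆ (vs⊆ r∈) ∷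
                                rest⊆ (vs′⊆ p′∈) ∷ rest⊆ (vs′⊆ q′∈) ∷ rest⊆ (vs′⊆ r′∈) ∷ All.tabulate first⊆)
          right : ∀ {v} → v ∈ p′ ∷ q′ ∷ r′ ∷ first → v ∈ others
          right = others∋ ∘ there ∘ there ∘ there
          ≢first : ∀ {v} → v ∈ rest → All (v ≢_) first
          ≢first v∈ = All.tabulate (λ w∈ → ≢-sym (apart w∈ v∈))
          ≢cherry : ∀ {v} → v ∈ vs → All (v ≢_) (x ∷ u ∷ y ∷ p′ ∷ q′ ∷ r′ ∷ first)
          ≢cherry v∈ = let v∈′ = rest⊆ (vs⊆ v∈) in
            ≢-sym (x≢ v∈′) ∷ ≢-sym (u≢ v∈′) ∷ ≢-sym (y≢ v∈′) ∷
            apart′ v∈ p′∈ ∷ apart′ v∈ q′∈ ∷ apart′ v∈ r′∈ ∷ ≢first (vs⊆ v∈)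
      in P₈₊-obstruction good first-length
           ((p≢q ∷ p≢r ∷ ≢cherry p∈) ∷ (q≢r ∷ ≢cherry q∈) ∷ ≢cherry r∈ ∷
            (x≢u ∷ x≢y ∷ All.tabulate (x≢ ∘ right)) ∷
            (≢-sym y≢u ∷ All.tabulate (u≢ ∘ right)) ∷
            All.tabulate (y≢ ∘ right) ∷
            (p′≢q′ ∷ p′≢r′ ∷ ≢first (vs′⊆ p′∈)) ∷ (q′≢r′ ∷ ≢first (vs′⊆ q′∈)) ∷ ≢first (vs′⊆ r′∈) ∷ first-unique)
           repeated-u (All.tabulate (repeated ∘ others∋)) eqx eqy

-- From excluded families to lower bounds

n≤bound : ∀ a j t → (∀ {n k} (f : Fin n → EdgeColoring n k) .{{_ : NonZero k}} → a * k ^ j < n → ¬ GoodFamily n t k f) →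
          ∀ n → 0 ≤ n → ∀ k → Achievable n t k → n ≤ a * k ^ j
n≤bound a j t no-good zero    _ k       _          = z≤n
-- A colouring has values on the diagonal too, so with no colours there is none once a vertex
-- exists. This leaves `k` nonzero, as the estimates require.
n≤bound a j t no-good (suc n) _ zero    (f , _)    = contradiction (colour (f zero) zero zero) λ ()
n≤bound a j t no-good (suc n) _ (suc k) (f , good) = ≮⇒≥ λ lt → no-good f lt good

theorem4 : (∃₂ λ (a N : ℕ) → ∀ n → N ≤ n → ∀ k → Achievable n 4 k → n ≤ a * k ^ 5)
    × (∀ t → 5 ≤ t → t ≤ 7 →
    ∃₂ λ (a N : ℕ) → ∀ n → N ≤ n → ∀ k → Achievable n t k → n ≤ a * k ^ 3)
    × (∀ t → 8 ≤ t →
    ∃₂ λ (a N : ℕ) → ∀ n → N ≤ n → ∀ k → Achievable n t k → n ≤ a * k ^ 2)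
theorem4 = (36 , 0 , n≤bound 36 5 4 (λ f → no-good-family-P₄ f)) , P₅₊ , P₈₊
  where
  P₅₊ : ∀ t → 5 ≤ t → t ≤ 7 →
        ∃₂ λ (a N : ℕ) → ∀ n → N ≤ n → ∀ k → Achievable n t k → n ≤ a * k ^ 3
  -- `e = t - 5` counts the vertices beyond `x u y p q r`; the constant depends on `t` alone and the
  -- bound holds from `N = 0` on.
  P₅₊ t 5≤t _ with e , refl ← m≤n⇒∃[o]m+o≡n 5≤t =
    12 + 4 * e , 0 , n≤bound (12 + 4 * e) 3 (5 + e)
      (λ {_} {k} f lt → no-good-family-P₅₊ f (cherry f _ (≤-trans (room-for-P₅₊ e k) lt)))
  P₈₊ : ∀ t → 8 ≤ t →
        ∃₂ λ (a N : ℕ) → ∀ n → N ≤ n → ∀ k → Achievable n t k → n ≤ a * k ^ 2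
  P₈₊ t 8≤t with e , refl ← m≤n⇒∃[o]m+o≡n 8≤t =
    24 + 4 * e , 0 , n≤bound (24 + 4 * e) 2 (8 + e)
      (λ {_} {k} f lt → no-good-family-P₈₊ f (cherry f _ (≤-trans (room-for-P₈₊ e k) lt)))
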